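{- If there exist a CMDRR$(n,k)$, a SAMDRR$(m)$, and two mutually orthogonal latin squares of order $n$, then there exists a CMDRR$(mn, mk)$.
   Context: A mixed doubles game is a match between two teams, each team consisting of one man and one woman; in a game $M_a F_b$ v $M_c F_d$, $M_a$ and $F_b$ are partners, $M_c$ and $F_d$ are partners, and each player of one team opposes each player of the other team. A complete mixed doubles round robin tournament CMDRR$(n,k)$ is a schedule (set) of mixed doubles games for $n$ men and $n$ women, of which $k$ men and $k$ women are paired into $k$ spouse pairs (a spouse pair is one man and one woman), such that: spouses never play in a game together as partners or opponents; every man and woman who are not spouses are partners exactly once and opponents exactly once; each player who has a spouse opposes every other player of the same sex exactly once; each player who does not have a spouse opposes some other same-sex player who does not have a spouse exactly twice and opposes all other same-sex players exactly once. A spouse-avoiding mixed doubles round robin tournament SAMDRR$(m)$ is a schedule of mixed doubles games for $m$ husband-and-wife couples in which spouses never play in a game together as partners or opponents, every man and woman who are not spouses are partners exactly once and opponents exactly once, and every pair of players of the same sex are opponents exactly once (i.e. a CMDRR$(m,m)$). -}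

module Defs where

open import Data.Fin.Base using (Fin)
open import Data.Fin.Properties using (_≟_)
open import Data.List.Base using (List; length; filter)
open import Data.List.Membership.Propositional using (_∈_)
open import Data.Nat.Base using (ℕ)
open import Data.Product.Base using (∃; ∃-syntax; _×_; _,_)
open import Data.Product using (∃!)
open import Data.Sum.Base using (_⊎_)
open import Function.Definitions using (Injective)
open import Level using (0ℓ)
open import Relation.Binary.Core using (Rel; REL)
open import Relation.Binary.PropositionalEquality.Core using (_≡_; _≢_)
open import Relation.Nullary.Decidable.Core using (Dec; _×-dec_; _⊎-dec_)
open import Relation.Nullary.Negation.Core using (¬_)

data Player (n : ℕ) : Set where
  man   : Fin n → Player n
  woman : Fin n → Player n

data SameSex {n : ℕ} : Rel (Player n) 0ℓ where
  men   : ∀ {a b} → SameSex (man a) (man b)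
  women : ∀ {a b} → SameSex (woman a) (woman b)

record Team (n : ℕ) : Set where
  constructor M_F_
  field
    itsMan   : Fin n
    itsWoman : Fin n

open Team public

record Game (n : ℕ) : Set where
  field
    team₁ team₂    : Team n
    distinct-men   : itsMan team₁ ≢ itsMan team₂
    distinct-women : itsWoman team₁ ≢ itsWoman team₂

open Game public

module _ {n : ℕ} where

  PlaysFor : REL (Player n) (Team n) 0ℓ
  PlaysFor (man a)   t = itsMan t ≡ a
  PlaysFor (woman b) t = itsWoman t ≡ b

  Partners : Fin n → Fin n → Game n → Set
  Partners a b g =
      (PlaysFor (man a) (team₁ g) × PlaysFor (woman b) (team₁ g))
    ⊎ (PlaysFor (man a) (team₂ g) × PlaysFor (woman b) (team₂ g))

  Opponents : Player n → Player n → Game n → Set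
  Opponents p q g =
      (PlaysFor p (team₁ g) × PlaysFor q (team₂ g))
    ⊎ (PlaysFor p (team₂ g) × PlaysFor q (team₁ g))

  playsFor? : ∀ p t → Dec (PlaysFor p t)
  playsFor? (man a)   t = itsMan t ≟ a
  playsFor? (woman b) t = itsWoman t ≟ b

  partners? : ∀ a b g → Dec (Partners a b g)
  partners? a b g =
    (playsFor? (man a) (team₁ g) ×-dec playsFor? (woman b) (team₁ g)) ⊎-dec
    (playsFor? (man a) (team₂ g) ×-dec playsFor? (woman b) (team₂ g))

  opponents? : ∀ p q g → Dec (Opponents p q g)
  opponents? p q g =
    (playsFor? p (team₁ g) ×-dec playsFor? q (team₂ g)) ⊎-dec
    (playsFor? p (team₂ g) ×-dec playsFor? q (team₁ g))

  timesPartners : List (Game n) → Fin n → Fin n → ℕ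
  timesPartners games a b = length (filter (partners? a b) games)

  timesOpponents : List (Game n) → Player n → Player n → ℕ
  timesOpponents games p q = length (filter (opponents? p q) games)

-- The conditions on spouses and on pairs of opposite sex, for a relation
-- Spouses a b saying that man a and woman b are married.  A list that meets
-- them cannot repeat a game, in either order of its teams: the partners in a
-- game are never spouses, so they are partners in no other entry.
record SpouseAvoiding {n : ℕ} (Spouses : Fin n → Fin n → Set)
                      (games : List (Game n)) : Set where
  field
    spouses-not-partners : ∀ {a b g} → Spouses a b → g ∈ games →
                           ¬ Partners a b g
    spouses-not-opponents : ∀ {a b g} → Spouses a b → g ∈ games →
                            ¬ Opponents (man a) (woman b) g
    partners-once : ∀ a b → ¬ Spouses a b → timesPartners games a b ≡ 1
    opponents-once : ∀ a b → ¬ Spouses a b →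
                     timesOpponents games (man a) (woman b) ≡ 1

HasSpouse : ∀ {n} → (Fin n → Fin n → Set) → Player n → Set
HasSpouse Spouses (man a)   = ∃[ b ] Spouses a b
HasSpouse Spouses (woman b) = ∃[ a ] Spouses a b

record CMDRR (n k : ℕ) : Set where
  field
    husband           : Fin k → Fin n
    wife              : Fin k → Fin n
    husband-injective : Injective _≡_ _≡_ husband
    wife-injective    : Injective _≡_ _≡_ wife

  Spouses : Fin n → Fin n → Set
  Spouses a b = ∃[ i ] (husband i ≡ a × wife i ≡ b)

  field
    games           : List (Game n)
    spouse-avoiding : SpouseAvoiding Spouses games
    spoused         : ∀ p → HasSpouse Spouses p →
                      ∀ q → SameSex p q → p ≢ q → timesOpponents games p q ≡ 1
    unspoused       : ∀ p → ¬ HasSpouse Spouses p →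
                      ∃[ q ] (SameSex p q × p ≢ q × ¬ HasSpouse Spouses q
                              × timesOpponents games p q ≡ 2
                              × (∀ r → SameSex p r → p ≢ r → q ≢ r →
                                 timesOpponents games p r ≡ 1))

-- Man i and woman i form the i-th couple.
record SAMDRR (m : ℕ) : Set where
  field
    games           : List (Game m)
    spouse-avoiding : SpouseAvoiding _≡_ games
    same-sex        : ∀ p q → SameSex p q → p ≢ q → timesOpponents games p q ≡ 1

Square : ℕ → Set
Square n = Fin n → Fin n → Fin n

record IsLatin {n : ℕ} (L : Square n) : Set where
  field
    row    : ∀ r s → ∃! _≡_ λ c → L r c ≡ s
    column : ∀ c s → ∃! _≡_ λ r → L r c ≡ s

Orthogonal : ∀ {n} → Square n → Square n → Set
Orthogonal {n} L L′ =
  ∀ s s′ → ∃! {A = Fin n × Fin n} _≡_ λ (r , c) → L r c ≡ s × L′ r c ≡ s′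

record TwoMOLS (n : ℕ) : Set where
  field
    L₁ L₂      : Square n
    latin₁     : IsLatin L₁
    latin₂     : IsLatin L₂
    orthogonal : Orthogonal L₁ L₂

{-# OPTIONS --safe #-}
-- Replace every player by a group of players: player x of group i is combine i x.  Two players
-- of the same group meet in that group's copy of the CMDRR(n,k).  A game between the groups of
-- a, b, c, d in the SAMDRR(m) becomes the n² games given by the orthogonal array of the two
-- squares: in game (r , c) the man of team₁ is number r, the man of team₂ number c, and the
-- women are numbers L₁ r c and L₂ r c.  Any two of the four coordinates determine (r , c), so
-- players of groups that meet once meet once themselves.
module Submission where

open import Defs
open import Data.Fin.Base using (Fin; combine; remQuot)
open import Data.Fin.Properties
  using (_≟_; combine-injective; combine-injectiveˡ; combine-injectiveʳ; combine-surjective;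
         remQuot-combine)
open import Data.List.Base
  using (List; []; _∷_; _++_; length; filter; map; allFin; cartesianProduct;
         cartesianProductWith)
open import Data.List.Membership.Propositional using (_∈_)
open import Data.List.Membership.Propositional.Properties
  using (∈-allFin; ∈-cartesianProduct⁺; ∈-cartesianProductWith⁻; ∈-filter⁺)
open import Data.List.Properties
  using (filter-accept; filter-reject; filter-none; filter-++; length-++)
open import Data.List.Relation.Unary.All as All using (tabulate)
open import Data.List.Relation.Unary.All.Properties using () renaming (map⁺ to All-map⁺)
open import Data.List.Relation.Unary.AllPairs using (_∷_)
open import Data.List.Relation.Unary.Any using (here; there)
open import Data.List.Relation.Unary.Unique.Propositional using (Unique)
open import Data.List.Relation.Unary.Unique.Propositional.Properties
  using (allFin⁺; cartesianProduct⁺)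
open import Data.Nat.Base using (ℕ; _+_; _*_)
open import Data.Nat.Properties using (+-identityʳ)
open import Data.Product.Base using (∃-syntax; ∃₂; _×_; _,_; proj₁; proj₂; uncurry)
open import Data.Product using (∃!)
open import Data.Sum.Base using (_⊎_; inj₁; inj₂)
open import Function.Base using (_∘_)
open import Function.Definitions using (Injective)
open import Level using (0ℓ)
open import Relation.Binary.PropositionalEquality
  using (_≡_; _≢_; refl; sym; trans; cong; cong₂)
open import Relation.Nullary.Decidable using (yes; no; _×-dec_; _⊎-dec_)
open import Relation.Nullary.Negation using (¬_; contradiction)
open import Relation.Unary using (Pred; Decidable)

-- Counting list entries that satisfy a decidable predicate.

module _ {A : Set} {P : Pred A 0ℓ} (P? : Decidable P) where

  length-filter-none : ∀ {xs} → (∀ {x} → x ∈ xs → ¬ P x) → length (filter P? xs) ≡ 0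
  length-filter-none none = cong length (filter-none P? (tabulate none))

  length-filter≡0⇒none : ∀ {xs} → length (filter P? xs) ≡ 0 → ∀ {x} → x ∈ xs → ¬ P x
  length-filter≡0⇒none {xs} eq x∈xs px with filter P? xs | ∈-filter⁺ P? x∈xs px
  length-filter≡0⇒none () x∈xs px | _ ∷ _ | _

  length-filter-++ : ∀ xs ys → length (filter P? (xs ++ ys)) ≡
                               length (filter P? xs) + length (filter P? ys)
  length-filter-++ xs ys = trans (cong length (filter-++ P? xs ys)) (length-++ (filter P? xs))

module _ {B C : Set} {Q : Pred C 0ℓ} (Q? : Decidable Q) where

  length-filter-map-unique : ∀ (f : B → C) {ys y} → Unique ys → y ∈ ys → Q (f y) →
                             (∀ {z} → Q (f z) → y ≡ z) → length (filter Q? (map f ys)) ≡ 1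
  length-filter-map-unique f (y∉ys ∷ _) (here refl) qy unique =
    trans (cong length (filter-accept Q? qy))
          (cong (ℕ.suc ∘ length) (filter-none Q? (All-map⁺ (All.map (_∘ unique) y∉ys))))
  length-filter-map-unique f (x∉ys ∷ ys!) (there y∈ys) qy unique =
    trans (cong length (filter-reject Q? λ qx → All.lookup x∉ys y∈ys (sym (unique qx))))
          (length-filter-map-unique f ys! y∈ys qy unique)

  length-filter-map-none : ∀ (f : B → C) ys → (∀ y → ¬ Q (f y)) →
                           length (filter Q? (map f ys)) ≡ 0
  length-filter-map-none f ys none =
    cong length (filter-none Q? (All-map⁺ (All.universal none ys)))

  -- Each `x` yields a block `map (f x) ys`. The block holds exactly one hit if `P x`, because `ys`
  -- lists every `y` without repetition, and no hit otherwise.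
  length-filter-product : ∀ {A : Set} {P : Pred A 0ℓ} (P? : Decidable P) (f : A → B → C) {ys} →
    Unique ys → (∀ y → y ∈ ys) →
    (∀ {x} → P x → ∃! _≡_ λ y → Q (f x y)) → (∀ {x y} → Q (f x y) → P x) →
    ∀ xs → length (filter Q? (cartesianProductWith f xs ys)) ≡ length (filter P? xs)
  length-filter-product P? f ys! every once only [] = refl
  length-filter-product P? f {ys} ys! every once only (x ∷ xs)
    with IH ← length-filter-product P? f ys! every once only xs | P? x
  ... | yes px with y , qy , unique ← once px =
    trans (length-filter-++ Q? (map (f x) ys) _)
          (cong₂ _+_ (length-filter-map-unique (f x) ys! (every y) qy unique) IH)
  ... | no ¬px =
    trans (length-filter-++ Q? (map (f x) ys) _)
          (cong₂ _+_ (length-filter-map-none (f x) ys λ _ → ¬px ∘ only) IH)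

-- Seats of a game and meetings between them.

data Seat : Set where
  M₁ F₁ M₂ F₂ : Seat

-- The symmetry that exchanges the two teams; applied to both seats, it gives the second alternative
-- of each relation on games.
other : Seat → Seat
other M₁ = M₂
other F₁ = F₂
other M₂ = M₁
other F₂ = F₁

other-involutive : ∀ s → other (other s) ≡ s
other-involutive M₁ = refl
other-involutive F₁ = refl
other-involutive M₂ = refl
other-involutive F₂ = refl

other-injective : ∀ {s t} → other s ≡ other t → s ≡ t
other-injective {s} {t} eq =
  trans (sym (other-involutive s)) (trans (cong other eq) (other-involutive t))

at : ∀ {n} → Seat → Game n → Fin n
at M₁ g = itsMan (team₁ g)
at F₁ g = itsWoman (team₁ g)
at M₂ g = itsMan (team₂ g)
at F₂ g = itsWoman (team₂ g)

at-other : ∀ {n} s (g : Game n) → at s g ≢ at (other s) g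
at-other M₁ g = distinct-men g
at-other F₁ g = distinct-women g
at-other M₂ g = distinct-men g ∘ sym
at-other F₂ g = distinct-women g ∘ sym

-- Each relation of Defs is an instance, definitionally: Partners is Meets M₁ F₁, and Opponents
-- is Meets M₁ F₂, Meets M₁ M₂ or Meets F₁ F₂ according to the sexes of the players.
Meets : ∀ {n} → Seat → Seat → Fin n → Fin n → Game n → Set
Meets s t a b g = (at s g ≡ a × at t g ≡ b) ⊎ (at (other s) g ≡ a × at (other t) g ≡ b)

-- Built from the same combinators as `partners?` and `opponents?`, so that `timesMeet` at concrete
-- seats computes to `timesPartners` and `timesOpponents`.
meets? : ∀ {n} s t (a b : Fin n) → Decidable (Meets s t a b)
meets? s t a b g = (at s g ≟ a ×-dec at t g ≟ b) ⊎-dec (at (other s) g ≟ a ×-dec at (other t) g ≟ b)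

timesMeet : ∀ {n} → Seat → Seat → List (Game n) → Fin n → Fin n → ℕ
timesMeet s t games a b = length (filter (meets? s t a b) games)

timesMeet-other : ∀ {n} s (games : List (Game n)) a → timesMeet s (other s) games a a ≡ 0
timesMeet-other s games a = length-filter-none (meets? s (other s) a a) {games} λ {g} _ → never g
  where
  never : ∀ g → ¬ Meets s (other s) a a g
  never g (inj₁ (p , q)) = at-other s g (trans p (sym q))
  never g (inj₂ (p , q)) = at-other (other s) g (trans p (sym q))

-- The orthogonal array of the two squares.

coordinate : ∀ {n} → TwoMOLS n → Seat → Fin n × Fin n → Fin n
coordinate mols M₁ (r , c) = r
coordinate mols F₁ (r , c) = TwoMOLS.L₁ mols r c
coordinate mols M₂ (r , c) = c
coordinate mols F₂ (r , c) = TwoMOLS.L₂ mols r c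

∃!-swap : ∀ {A : Set} {P Q : Pred A 0ℓ} → (∃! _≡_ λ z → P z × Q z) → ∃! _≡_ λ z → Q z × P z
∃!-swap (z , (p , q) , unique) = z , (q , p) , λ (q′ , p′) → unique (p′ , q′)

row-∃! : ∀ {n} {L : Square n} → IsLatin L → ∀ x y →
         ∃! _≡_ λ ((r , c) : Fin n × Fin n) → r ≡ x × L r c ≡ y
row-∃! latin x y with c , eq , unique ← IsLatin.row latin x y =
  (x , c) , (refl , eq) , λ where (refl , eq′) → cong (x ,_) (unique eq′)

column-∃! : ∀ {n} {L : Square n} → IsLatin L → ∀ x y →
            ∃! _≡_ λ ((r , c) : Fin n × Fin n) → c ≡ x × L r c ≡ y
column-∃! latin x y with r , eq , unique ← IsLatin.column latin x y =
  (r , x) , (refl , eq) , λ where (refl , eq′) → cong (_, x) (unique eq′)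

-- The array has strength two: a row or column index together with an entry is the latin property,
-- the two entries together are orthogonality, and the two indices are the cell itself.
coordinates-∃! : ∀ {n} (mols : TwoMOLS n) {s t} → s ≢ t → ∀ x y →
                 ∃! _≡_ λ rc → coordinate mols s rc ≡ x × coordinate mols t rc ≡ y
coordinates-∃! mols {s} {t} s≢t = go s t s≢t
  where
  open TwoMOLS mols
  go : ∀ s t → s ≢ t → ∀ x y →
       ∃! _≡_ λ rc → coordinate mols s rc ≡ x × coordinate mols t rc ≡ y
  go M₁ M₁ s≢t x y = contradiction refl s≢t
  go M₁ F₁ s≢t x y = row-∃! latin₁ x y
  go M₁ M₂ s≢t x y = (x , y) , (refl , refl) , λ where (refl , refl) → refl
  go M₁ F₂ s≢t x y = row-∃! latin₂ x y
  go F₁ M₁ s≢t x y = ∃!-swap (row-∃! latin₁ y x)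
  go F₁ F₁ s≢t x y = contradiction refl s≢t
  go F₁ M₂ s≢t x y = ∃!-swap (column-∃! latin₁ y x)
  go F₁ F₂ s≢t x y = orthogonal x y
  go M₂ M₁ s≢t x y = (y , x) , (refl , refl) , λ where (refl , refl) → refl
  go M₂ F₁ s≢t x y = column-∃! latin₁ x y
  go M₂ M₂ s≢t x y = contradiction refl s≢t
  go M₂ F₂ s≢t x y = column-∃! latin₂ x y
  go F₂ M₁ s≢t x y = ∃!-swap (row-∃! latin₂ y x)
  go F₂ F₁ s≢t x y = ∃!-swap (orthogonal y x)
  go F₂ M₂ s≢t x y = ∃!-swap (column-∃! latin₂ y x)
  go F₂ F₂ s≢t x y = contradiction refl s≢t

-- The two kinds of games in the product.

copy : ∀ {m n} → Game n → Fin m → Game (m * n)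
copy g i = record
  { team₁ = M combine i (at M₁ g) F combine i (at F₁ g)
  ; team₂ = M combine i (at M₂ g) F combine i (at F₂ g)
  ; distinct-men   = distinct-men g ∘ combine-injectiveʳ i (at M₁ g) i (at M₂ g)
  ; distinct-women = distinct-women g ∘ combine-injectiveʳ i (at F₁ g) i (at F₂ g)
  }

-- True by computation once the seat is known; stated so that later arguments can keep the seat a
-- variable.
at-copy : ∀ {m n} s (g : Game n) (i : Fin m) → at s (copy g i) ≡ combine i (at s g)
at-copy M₁ g i = refl
at-copy F₁ g i = refl
at-copy M₂ g i = refl
at-copy F₂ g i = refl

-- Opposing players may have equal numbers here, so distinctness rests on their groups; in `copy`
-- the group is shared and it rests on the numbers.
inflate : ∀ {m n} → TwoMOLS n → Game m → Fin n × Fin n → Game (m * n)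
inflate mols g rc = record
  { team₁ = M combine (at M₁ g) (coordinate mols M₁ rc) F combine (at F₁ g) (coordinate mols F₁ rc)
  ; team₂ = M combine (at M₂ g) (coordinate mols M₂ rc) F combine (at F₂ g) (coordinate mols F₂ rc)
  ; distinct-men   = distinct-men g ∘ combine-injectiveˡ (at M₁ g) _ (at M₂ g) _
  ; distinct-women = distinct-women g ∘ combine-injectiveˡ (at F₁ g) _ (at F₂ g) _
  }

at-inflate : ∀ {m n} (mols : TwoMOLS n) s (g : Game m) rc →
             at s (inflate mols g rc) ≡ combine (at s g) (coordinate mols s rc)
at-inflate mols M₁ g rc = refl
at-inflate mols F₁ g rc = refl
at-inflate mols M₂ g rc = refl
at-inflate mols F₂ g rc = refl

copies : ∀ {n} m → List (Game n) → List (Game (m * n))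
copies m games = cartesianProductWith copy games (allFin m)

inflations : ∀ {m n} → TwoMOLS n → List (Game m) → List (Game (m * n))
inflations {n = n} mols games =
  cartesianProductWith (inflate mols) games (cartesianProduct (allFin n) (allFin n))

-- Counting meetings in copies and in inflated games.

module _ {m n : ℕ} {s t : Seat} {i j : Fin m} {x y : Fin n} where

  -- Both group equations are kept: together they exclude meetings across groups, and either one
  -- determines which copy it is.
  Meets-copy⁻ : ∀ {g l} → Meets s t (combine i x) (combine j y) (copy g l) →
                (l ≡ i × l ≡ j) × Meets s t x y g
  Meets-copy⁻ {g} {l} (inj₁ (p , q))
    with l≡i , p′ ← combine-injective l _ i x (trans (sym (at-copy s g l)) p)
       | l≡j , q′ ← combine-injective l _ j y (trans (sym (at-copy t g l)) q)
    = (l≡i , l≡j) , inj₁ (p′ , q′)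
  Meets-copy⁻ {g} {l} (inj₂ (p , q))
    with l≡i , p′ ← combine-injective l _ i x (trans (sym (at-copy (other s) g l)) p)
       | l≡j , q′ ← combine-injective l _ j y (trans (sym (at-copy (other t) g l)) q)
    = (l≡i , l≡j) , inj₂ (p′ , q′)

  timesMeet-copies-≢ : i ≢ j → ∀ games →
                       timesMeet s t (copies m games) (combine i x) (combine j y) ≡ 0
  timesMeet-copies-≢ i≢j games = length-filter-none (meets? s t _ _) λ g∈ meets →
    case-copy (∈-cartesianProductWith⁻ copy games (allFin m) g∈) meets
    where
    case-copy : ∀ {h} → ∃₂ (λ g l → g ∈ games × l ∈ allFin m × h ≡ copy g l) →
                ¬ Meets s t (combine i x) (combine j y) h
    case-copy (g , l , _ , _ , refl) meets with (l≡i , l≡j) , _ ← Meets-copy⁻ {g} {l} meets =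
      i≢j (trans (sym l≡i) l≡j)

  module _ (mols : TwoMOLS n) where

    private
      Seated : Seat → Seat → Fin n × Fin n → Set
      Seated s t rc = coordinate mols s rc ≡ x × coordinate mols t rc ≡ y

      -- A meeting split into a condition on groups and one on numbers, with the same orientation of
      -- the teams in both.
      Inflated : Game m → Fin n × Fin n → Set
      Inflated g rc =
        ((at s g ≡ i × at t g ≡ j) × Seated s t rc) ⊎
        ((at (other s) g ≡ i × at (other t) g ≡ j) × Seated (other s) (other t) rc)

    Meets-inflate⁻ : ∀ {g rc} → Meets s t (combine i x) (combine j y) (inflate mols g rc) →
                     Inflated g rc
    Meets-inflate⁻ {g} {rc} (inj₁ (p , q))
      with a , b ← combine-injective _ _ i x (trans (sym (at-inflate mols s g rc)) p)
         | c , d ← combine-injective _ _ j y (trans (sym (at-inflate mols t g rc)) q)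
      = inj₁ ((a , c) , (b , d))
    Meets-inflate⁻ {g} {rc} (inj₂ (p , q))
      with a , b ← combine-injective _ _ i x (trans (sym (at-inflate mols (other s) g rc)) p)
         | c , d ← combine-injective _ _ j y (trans (sym (at-inflate mols (other t) g rc)) q)
      = inj₂ ((a , c) , (b , d))

    -- For a fixed orientation the cell is unique by strength two. The opposite orientation would
    -- put group `i` in both `s` and `other s`, against the distinctness of opponents in `g`.
    Meets-inflate-∃! : s ≢ t → ∀ {g} → Meets s t i j g →
      ∃! _≡_ λ rc → Meets s t (combine i x) (combine j y) (inflate mols g rc)
    Meets-inflate-∃! s≢t {g} (inj₁ (p , q))
      with rc , (u , v) , unique ← coordinates-∃! mols s≢t x y
      = rc
      , inj₁ (trans (at-inflate mols s g rc) (cong₂ combine p u) ,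
              trans (at-inflate mols t g rc) (cong₂ combine q v))
      , λ meets → from-inflate (Meets-inflate⁻ meets)
      where
      from-inflate : ∀ {rc′} → Inflated g rc′ → rc ≡ rc′
      from-inflate (inj₁ (_ , seated)) = unique seated
      from-inflate (inj₂ ((p′ , _) , _)) = contradiction (trans p (sym p′)) (at-other s g)
    Meets-inflate-∃! s≢t {g} (inj₂ (p , q))
      -- With the teams exchanged, the array is read at `other s` and `other t`, again two different
      -- coordinates.
      with rc , (u , v) , unique ← coordinates-∃! mols (s≢t ∘ other-injective) x y
      = rc
      , inj₂ (trans (at-inflate mols (other s) g rc) (cong₂ combine p u) ,
              trans (at-inflate mols (other t) g rc) (cong₂ combine q v))
      , λ meets → from-inflate (Meets-inflate⁻ meets)
      where
      from-inflate : ∀ {rc′} → Inflated g rc′ → rc ≡ rc′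
      from-inflate (inj₁ ((p′ , _) , _)) = contradiction (trans p′ (sym p)) (at-other s g)
      from-inflate (inj₂ (_ , seated)) = unique seated

    -- The count depends on the groups alone. It covers both `i ≡ j` and `i ≢ j`, and so serves
    -- pairs within a group and across groups.
    timesMeet-inflations : s ≢ t → ∀ games →
      timesMeet s t (inflations mols games) (combine i x) (combine j y) ≡ timesMeet s t games i j
    timesMeet-inflations s≢t =
      length-filter-product (meets? s t _ _) (meets? s t i j) (inflate mols)
        (cartesianProduct⁺ (allFin⁺ n) (allFin⁺ n))
        (λ (r , c) → ∈-cartesianProduct⁺ (∈-allFin r) (∈-allFin c))
        (Meets-inflate-∃! s≢t)
        λ {g} meets → forget (Meets-inflate⁻ {g} meets)
      where
      forget : ∀ {g rc} → Inflated g rc → Meets s t i j g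
      forget (inj₁ (m , _)) = inj₁ m
      forget (inj₂ (m , _)) = inj₂ m

-- Among the `m` copies of a game, only the one for group `i` seats players of that group.
timesMeet-copies-≡ : ∀ {m n s t} {i : Fin m} {x y : Fin n} games →
  timesMeet s t (copies m games) (combine i x) (combine i y) ≡ timesMeet s t games x y
timesMeet-copies-≡ {m} {n} {s} {t} {i} {x} {y} =
  length-filter-product (meets? s t _ _) (meets? s t x y) copy (allFin⁺ m) ∈-allFin
    (λ {g} meets → i , lift g meets , λ {l} → sym ∘ proj₁ ∘ proj₁ ∘ split g l)
    λ {g} {l} → proj₂ ∘ split g l
  where
  split : ∀ g l → Meets s t (combine i x) (combine i y) (copy g l) →
          (l ≡ i × l ≡ i) × Meets s t x y g
  split g l = Meets-copy⁻ {s = s} {t} {i} {i} {x} {y} {g} {l}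

  lift : ∀ g → Meets s t x y g → Meets s t (combine i x) (combine i y) (copy g i)
  lift g (inj₁ (p , q)) = inj₁ (trans (at-copy s g i) (cong (combine i) p) ,
                                trans (at-copy t g i) (cong (combine i) q))
  lift g (inj₂ (p , q)) = inj₂ (trans (at-copy (other s) g i) (cong (combine i) p) ,
                                trans (at-copy (other t) g i) (cong (combine i) q))

-- Players placed in groups.

place : ∀ {m n} → Fin m → Player n → Player (m * n)
place i (man x)   = man (combine i x)
place i (woman x) = woman (combine i x)

place-surjective : ∀ {m n} (p : Player (m * n)) → ∃₂ λ (i : Fin m) (q : Player n) → place i q ≡ p
place-surjective {m} {n} (man a) with i , x , refl ← combine-surjective {m} {n} a =
  i , man x , refl
place-surjective {m} {n} (woman b) with i , x , refl ← combine-surjective {m} {n} b =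
  i , woman x , refl

place-injective : ∀ {m n} {i : Fin m} {p q : Player n} → place i p ≡ place i q → p ≡ q
place-injective {i = i} {man x} {man y} eq =
  cong man (combine-injectiveʳ i x i y (man-injective eq))
  where
  man-injective : ∀ {n} {a b : Fin n} → man a ≡ man b → a ≡ b
  man-injective refl = refl
place-injective {i = i} {woman x} {woman y} eq =
  cong woman (combine-injectiveʳ i x i y (woman-injective eq))
  where
  woman-injective : ∀ {n} {a b : Fin n} → woman a ≡ woman b → a ≡ b
  woman-injective refl = refl

SameSex-place⁺ : ∀ {m n} {i j : Fin m} {p q : Player n} →
                 SameSex p q → SameSex (place i p) (place j q)
SameSex-place⁺ men   = men
SameSex-place⁺ women = women

SameSex-place⁻ : ∀ {m n} {i j : Fin m} (p q : Player n) →
                 SameSex (place i p) (place j q) → SameSex p q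
SameSex-place⁻ (man _)   (man _)   men   = men
SameSex-place⁻ (woman _) (woman _) women = women

-- The product tournament and its spouse pairs.

module Product {m n k : ℕ} (cmdrr : CMDRR n k) (samdrr : SAMDRR m) (mols : TwoMOLS n) where

  private
    module C = CMDRR cmdrr
    module S = SAMDRR samdrr
    module CA = SpouseAvoiding C.spouse-avoiding
    module SA = SpouseAvoiding S.spouse-avoiding

  private
    module _ (f : Fin k → Fin n) where

      -- Couple `l` of group `i` gets the index `combine i l`, so `husband` and `wife` decode an
      -- index to the same group.
      blockwise : Fin (m * k) → Fin (m * n)
      blockwise h = uncurry (λ i l → combine i (f l)) (remQuot {m} k h)

      blockwise-combine : ∀ i l → blockwise (combine i l) ≡ combine i (f l)
      blockwise-combine i l = cong (uncurry λ i l → combine i (f l)) (remQuot-combine {m} {k} i l)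

      blockwise-injective : Injective _≡_ _≡_ f → Injective _≡_ _≡_ blockwise
      blockwise-injective inj {g} {h} eq
        with i , u , refl ← combine-surjective {m} {k} g
           | j , v , refl ← combine-surjective {m} {k} h
        with refl , eq′ ← combine-injective i (f u) j (f v)
                            (trans (sym (blockwise-combine i u)) (trans eq (blockwise-combine j v)))
        = cong (combine i) (inj eq′)

  husband wife : Fin (m * k) → Fin (m * n)
  husband = blockwise C.husband
  wife    = blockwise C.wife

  Spouses : Fin (m * n) → Fin (m * n) → Set
  Spouses a b = ∃[ h ] (husband h ≡ a × wife h ≡ b)

  Spouses-combine⁺ : ∀ {i x y} → C.Spouses x y → Spouses (combine i x) (combine i y)
  Spouses-combine⁺ {i} (l , refl , refl) =
    combine i l , blockwise-combine C.husband i l , blockwise-combine C.wife i l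

  Spouses-combine⁻ : ∀ {i j x y} → Spouses (combine i x) (combine j y) → i ≡ j × C.Spouses x y
  Spouses-combine⁻ {i} {j} {x} {y} (h , p , q)
    with e , l , refl ← combine-surjective {m} {k} h
    with refl , p′ ← combine-injective e (C.husband l) i x
                       (trans (sym (blockwise-combine C.husband e l)) p)
    with refl , q′ ← combine-injective e (C.wife l) j y
                       (trans (sym (blockwise-combine C.wife e l)) q)
    = refl , l , p′ , q′

  HasSpouse-place⁺ : ∀ {i : Fin m} p → HasSpouse C.Spouses p → HasSpouse Spouses (place i p)
  HasSpouse-place⁺ {i} (man _)   (y , sp) = combine i y , Spouses-combine⁺ sp
  HasSpouse-place⁺ {i} (woman _) (y , sp) = combine i y , Spouses-combine⁺ sp

  HasSpouse-place⁻ : ∀ {i : Fin m} p → HasSpouse Spouses (place i p) → HasSpouse C.Spouses p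
  HasSpouse-place⁻ (man _) (b , sp) with j , y , refl ← combine-surjective {m} {n} b =
    y , proj₂ (Spouses-combine⁻ sp)
  HasSpouse-place⁻ (woman _) (a , sp) with j , x , refl ← combine-surjective {m} {n} a =
    x , proj₂ (Spouses-combine⁻ sp)

  -- Meetings within a group and across groups.

  games : List (Game (m * n))
  games = copies m C.games ++ inflations mols S.games

  -- When group `i` never meets itself in the SAMDRR at these seats, the inflated games contribute
  -- nothing and only the copies count.
  timesMeet-within : ∀ {s t} → s ≢ t → ∀ {i x y} → timesMeet s t S.games i i ≡ 0 →
                     timesMeet s t games (combine i x) (combine i y) ≡ timesMeet s t C.games x y
  timesMeet-within {s} {t} s≢t {i} {x} {y} never =
    trans (length-filter-++ (meets? s t _ _) (copies m C.games) _)
      (trans (cong₂ _+_ (timesMeet-copies-≡ {s = s} {t} C.games)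
                        (trans (timesMeet-inflations mols s≢t S.games) never))
             (+-identityʳ _))

  timesMeet-across : ∀ {s t} → s ≢ t → ∀ {i j x y} → i ≢ j →
                     timesMeet s t games (combine i x) (combine j y) ≡ timesMeet s t S.games i j
  timesMeet-across {s} {t} s≢t i≢j =
    trans (length-filter-++ (meets? s t _ _) (copies m C.games) _)
      (cong₂ _+_ (timesMeet-copies-≢ {s = s} {t} i≢j C.games) (timesMeet-inflations mols s≢t S.games))

  -- The men and the women of group `i` come from couple `i` of the SAMDRR; because that couple
  -- avoids each other, partnerships inside a group are left to its copy.
  couples-never-partners : ∀ i → timesPartners S.games i i ≡ 0
  couples-never-partners i =
    length-filter-none (partners? i i) (SA.spouses-not-partners refl)

  couples-never-opponents : ∀ i → timesOpponents S.games (man i) (woman i) ≡ 0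
  couples-never-opponents i =
    length-filter-none (opponents? (man i) (woman i)) (SA.spouses-not-opponents refl)

  -- Conditions on spouses and on opposite sexes.

  spouse-avoiding : SpouseAvoiding Spouses games
  spouse-avoiding = record
    { spouses-not-partners  = not-partners
    ; spouses-not-opponents = not-opponents
    ; partners-once         = partners-once
    ; opponents-once        = opponents-once
    }
    where
    not-partners : ∀ {a b g} → Spouses a b → g ∈ games → ¬ Partners a b g
    not-partners {a} {b} sp
      with i , x , refl ← combine-surjective {m} {n} a
         | j , y , refl ← combine-surjective {m} {n} b
      with refl , sp′ ← Spouses-combine⁻ sp
      -- Absence is derived from a count: the spouses meet 0 times in the product because they meet
      -- 0 times in the CMDRR.
      = length-filter≡0⇒none (partners? _ _)
          (trans (timesMeet-within {M₁} {F₁} (λ ()) (couples-never-partners i))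
                 (length-filter-none (partners? x y) (CA.spouses-not-partners sp′)))

    not-opponents : ∀ {a b g} → Spouses a b → g ∈ games → ¬ Opponents (man a) (woman b) g
    not-opponents {a} {b} sp
      with i , x , refl ← combine-surjective {m} {n} a
         | j , y , refl ← combine-surjective {m} {n} b
      with refl , sp′ ← Spouses-combine⁻ sp
      = length-filter≡0⇒none (opponents? (man _) (woman _))
          (trans (timesMeet-within {M₁} {F₂} (λ ()) (couples-never-opponents i))
                 (length-filter-none (opponents? (man x) (woman y))
                                     (CA.spouses-not-opponents sp′)))

    partners-once : ∀ a b → ¬ Spouses a b → timesPartners games a b ≡ 1
    partners-once a b ¬sp
      with i , x , refl ← combine-surjective {m} {n} a
         | j , y , refl ← combine-surjective {m} {n} b
      with i ≟ j
    ... | yes refl = trans (timesMeet-within {M₁} {F₁} (λ ()) (couples-never-partners i))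
                           (CA.partners-once x y (¬sp ∘ Spouses-combine⁺))
    -- Couples of the SAMDRR are equal indices, so `i≢j` is itself the proof that these two are not
    -- spouses there.
    ... | no i≢j = trans (timesMeet-across {M₁} {F₁} (λ ()) i≢j) (SA.partners-once i j i≢j)

    opponents-once : ∀ a b → ¬ Spouses a b → timesOpponents games (man a) (woman b) ≡ 1
    opponents-once a b ¬sp
      with i , x , refl ← combine-surjective {m} {n} a
         | j , y , refl ← combine-surjective {m} {n} b
      with i ≟ j
    ... | yes refl = trans (timesMeet-within {M₁} {F₂} (λ ()) (couples-never-opponents i))
                           (CA.opponents-once x y (¬sp ∘ Spouses-combine⁺))
    ... | no i≢j = trans (timesMeet-across {M₁} {F₂} (λ ()) i≢j) (SA.opponents-once i j i≢j)

  -- Conditions on players of the same sex.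

  sameSex-within : ∀ {i p q} → SameSex p q →
                   timesOpponents games (place i p) (place i q) ≡ timesOpponents C.games p q
  -- Distinctness of the two men in a game takes the role that spouse avoidance has for opposite
  -- sexes.
  sameSex-within {i} men   = timesMeet-within {M₁} {M₂} (λ ()) (timesMeet-other M₁ S.games i)
  sameSex-within {i} women = timesMeet-within {F₁} {F₂} (λ ()) (timesMeet-other F₁ S.games i)

  sameSex-across : ∀ {i j p q} → i ≢ j → SameSex p q →
                   timesOpponents games (place i p) (place j q) ≡ 1
  sameSex-across {i} {j} i≢j men =
    trans (timesMeet-across {M₁} {M₂} (λ ()) i≢j)
          (S.same-sex (man i) (man j) men λ where refl → i≢j refl)
  sameSex-across {i} {j} i≢j women =
    trans (timesMeet-across {F₁} {F₂} (λ ()) i≢j)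
          (S.same-sex (woman i) (woman j) women λ where refl → i≢j refl)

  spoused : ∀ p → HasSpouse Spouses p →
            ∀ q → SameSex p q → p ≢ q → timesOpponents games p q ≡ 1
  spoused p has q same p≢q
    with i , p′ , refl ← place-surjective {m} {n} p
       | j , q′ , refl ← place-surjective {m} {n} q
    with same′ ← SameSex-place⁻ p′ q′ same | i ≟ j
  ... | yes refl = trans (sameSex-within same′)
                         (C.spoused p′ (HasSpouse-place⁻ p′ has) q′ same′ (p≢q ∘ cong (place i)))
  ... | no i≢j = sameSex-across i≢j same′

  unspoused : ∀ p → ¬ HasSpouse Spouses p →
              ∃[ q ] (SameSex p q × p ≢ q × ¬ HasSpouse Spouses q
                      × timesOpponents games p q ≡ 2
                      × (∀ r → SameSex p r → p ≢ r → q ≢ r → timesOpponents games p r ≡ 1))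
  unspoused p ¬has
    with i , p′ , refl ← place-surjective {m} {n} p
    with q′ , same , p≢q , ¬has′ , twice , once ← C.unspoused p′ (¬has ∘ HasSpouse-place⁺ p′)
    -- The opponent met twice is the one from the CMDRR, placed in the same group; players of other
    -- groups are met once through the inflated games.
    = place i q′ , SameSex-place⁺ same , p≢q ∘ place-injective , ¬has′ ∘ HasSpouse-place⁻ q′
    , trans (sameSex-within same) twice , once-each
    where
    once-each : ∀ r → SameSex (place i p′) r → place i p′ ≢ r → place i q′ ≢ r →
                timesOpponents games (place i p′) r ≡ 1
    once-each r same-r p≢r q≢r
      with j , r′ , refl ← place-surjective {m} {n} r
      with same′ ← SameSex-place⁻ p′ r′ same-r | i ≟ j
    ... | yes refl = trans (sameSex-within same′)
                           (once r′ same′ (p≢r ∘ cong (place i)) (q≢r ∘ cong (place i)))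
    ... | no i≢j = sameSex-across i≢j same′

  product : CMDRR (m * n) (m * k)
  product = record
    { husband           = husband
    ; wife              = wife
    ; husband-injective = blockwise-injective C.husband C.husband-injective
    ; wife-injective    = blockwise-injective C.wife C.wife-injective
    ; games             = games
    ; spouse-avoiding   = spouse-avoiding
    ; spoused           = spoused
    ; unspoused         = unspoused
    }

theorem9 : ∀ (m n k : ℕ) → CMDRR n k → SAMDRR m → TwoMOLS n → CMDRR (m * n) (m * k)
theorem9 m n k cmdrr samdrr mols = Product.product cmdrr samdrr mols
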